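{- Governed bisimilarity strictly refines both direct simulation equivalence and governed stuttering bisimilarity. That is, for each relation $\approx$ among these two: in every parity game, governed bisimilar vertices $v,w$ satisfy $v\approx w$; and there is a parity game with vertices $v,w$ such that $v\approx w$ but $v,w$ are not governed bisimilar.
   Context: A parity game is a tuple $(V,\to,\Omega,\mathcal P)$ where $V$ is a finite set of vertices, $\to\subseteq V\times V$ is total (every vertex has at least one successor), $\Omega:V\to\mathbb N$ is a priority function, and $\mathcal P:V\to\{\Diamond,\Box\}$ assigns each vertex to player even ($\Diamond$) or odd ($\Box$). Write $V_\Diamond,V_\Box$ for the vertices owned by each player and $v^\bullet=\{w\mid v\to w\}$. Governed bisimilarity: a symmetric $R\subseteq V\times V$ is a governed bisimulation iff $v\,R\,w$ implies: (1) $\Omega(v)=\Omega(w)$; (2) if $\mathcal P(v)\neq\mathcal P(w)$, then $v'\,R\,w'$ for all $v'\in v^\bullet$, $w'\in w^\bullet$; (3) for all $v'\in v^\bullet$ there is $w'\in w^\bullet$ with $v'\,R\,w'$. Vertices are governed bisimilar iff some governed bisimulation relates them. Direct simulation equivalence: $v\to_i T$ (one-step forcing) means: either $\mathcal P(v)=i$ and $v^\bullet\cap T\neq\emptyset$, or $\mathcal P(v)\neq i$ and $v^\bullet\subseteq T$. Put $vR=\{w\mid v\,R\,w\}$, $UR=\bigcup_{u\in U}uR$. $R\subseteq V\times V$ is a direct simulation iff $v\,R\,w$ implies $\Omega(v)=\Omega(w)$; if $v\in V_\Diamond$ then $w\to_\Diamond v'R$ for each $v'\in v^\bullet$; if $v\in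 V_\Box$ then $w\to_\Diamond v^\bullet R$. $v\leq_d w$ iff some direct simulation relates $v$ to $w$; $v,w$ are direct simulation equivalent iff $v\leq_d w$ and $w\leq_d v$. Governed stuttering bisimilarity: a memoryless strategy for player $i$ is a partial function $\sigma:V\to V$ defined only on vertices owned by $i$, with $v\to\sigma(v)$ whenever defined; it allows an infinite path $v_0v_1\dots$ iff $v_{j+1}=\sigma(v_j)$ whenever $\sigma(v_j)$ is defined. $v\mapsto_{i,U}T$ iff there is a memoryless strategy $\sigma$ for $i$ such that every infinite path $v_0v_1\dots$ with $v_0=v$ allowed by $\sigma$ has some $n$ with $v_n\in T$ and $v_j\in U$ for all $j<n$. $v\mapsto_{i,U}$ iff there is such $\sigma$ for which every infinite path from $v$ allowed by $\sigma$ stays in $U$ forever. An equivalence relation $R$ on $V$ is a governed stuttering bisimulation iff $v\,R\,w$ implies: (a) $\Omega(v)=\Omega(w)$; (b) for all $R$-classes $\mathcal C\neq[v]_R$, if $v$ has a successor in $\mathcal C$ then $w\mapsto_{\mathcal P(v),[w]_R}\mathcal C$; (c) for each player $i$, $v\mapsto_{i,[v]_R}$ implies $w\mapsto_{i,[w]_R}$. Vertices are governed stuttering bisimilar iff some governed stuttering bisimulation relates them. -}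

module Defs where

open import Data.Fin using (Fin)
open import Data.Maybe using (Maybe; just)
open import Data.Nat using (ℕ; zero; suc; _<_)
open import Data.Product using (Σ; ∃-syntax; _×_)
open import Data.Sum using (_⊎_)
open import Level using (0ℓ) renaming (suc to lsuc)
open import Relation.Binary using (Rel; Symmetric; IsEquivalence; Decidable)
open import Relation.Binary.PropositionalEquality using (_≡_; _≢_)
open import Relation.Nullary using (¬_)
open import Relation.Unary using (Pred; _∈_; _⊆_; _≬_)

data Player : Set where
  ◇ □ : Player

-- The edges of a finite graph form a finite set of pairs, so membership in
-- it is decidable; `_⟶?_` makes this explicit.  No such requirement is put on
-- the relations and vertex sets quantified over below.
record ParityGame : Set₁ where
  infix 4 _⟶_ _⟶?_
  field
    size  : ℕ
  V : Set
  V = Fin size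
  field
    _⟶_   : Rel V 0ℓ
    _⟶?_  : Decidable _⟶_
    total : ∀ v → ∃[ w ] v ⟶ w
    Ω     : V → ℕ
    𝒫     : V → Player

  infix 10 _•
  _• : V → Pred V 0ℓ
  v • = v ⟶_

module _ (G : ParityGame) where
  open ParityGame G

  record IsGovernedBisimulation (R : Rel V 0ℓ) : Set where
    field
      symmetric : Symmetric R
      priority  : ∀ {v w} → R v w → Ω v ≡ Ω w
      govern    : ∀ {v w} → R v w → 𝒫 v ≢ 𝒫 w →
                  ∀ {v′ w′} → v′ ∈ v • → w′ ∈ w • → R v′ w′
      transfer  : ∀ {v w} → R v w →
                  ∀ {v′} → v′ ∈ v • → ∃[ w′ ] (w′ ∈ w • × R v′ w′)

  GovernedBisimilar : Rel V (lsuc 0ℓ)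
  GovernedBisimilar v w = Σ (Rel V 0ℓ) λ R → IsGovernedBisimulation R × R v w

  Forces : Player → V → Pred V 0ℓ → Set
  Forces i v T = (𝒫 v ≡ i × (v •) ≬ T) ⊎ (𝒫 v ≢ i × (v •) ⊆ T)

  -- Image U R is the set UR; the set vR is written R v.
  Image : Pred V 0ℓ → Rel V 0ℓ → Pred V 0ℓ
  Image U R w = ∃[ u ] (u ∈ U × R u w)

  record IsDirectSimulation (R : Rel V 0ℓ) : Set where
    field
      priority : ∀ {v w} → R v w → Ω v ≡ Ω w
      even     : ∀ {v w} → R v w → 𝒫 v ≡ ◇ → ∀ {v′} → v′ ∈ v • → Forces ◇ w (R v′)
      odd      : ∀ {v w} → R v w → 𝒫 v ≡ □ → Forces ◇ w (Image (v •) R)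

  DirectlySimulatedBy : Rel V (lsuc 0ℓ)
  DirectlySimulatedBy v w = Σ (Rel V 0ℓ) λ R → IsDirectSimulation R × R v w

  DirectSimulationEquivalent : Rel V (lsuc 0ℓ)
  DirectSimulationEquivalent v w = DirectlySimulatedBy v w × DirectlySimulatedBy w v

  record Strategy (i : Player) : Set where
    field
      move  : V → Maybe V
      owned : ∀ {v w} → move v ≡ just w → 𝒫 v ≡ i
      legal : ∀ {v w} → move v ≡ just w → v ⟶ w

  record Path (v : V) : Set where
    field
      at    : ℕ → V
      start : at zero ≡ v
      step  : ∀ j → at j ⟶ at (suc j)

  open Path using (at)

  Allows : ∀ {i v} → Strategy i → Path v → Set
  Allows σ π = ∀ j {w} → Strategy.move σ (at π j) ≡ just w → at π (suc j) ≡ w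

  -- v ↦_{i,U} T
  ForcesVia : Player → Pred V 0ℓ → V → Pred V 0ℓ → Set
  ForcesVia i U v T =
    ∃[ σ ] ((π : Path v) → Allows {i} σ π →
            ∃[ n ] (at π n ∈ T × (∀ j → j < n → at π j ∈ U)))

  -- v ↦_{i,U}
  ForcesStaying : Player → Pred V 0ℓ → V → Set
  ForcesStaying i U v =
    ∃[ σ ] ((π : Path v) → Allows {i} σ π → ∀ n → at π n ∈ U)

  -- For an equivalence R, the class of u is R u, and it differs from the class
  -- of v exactly when ¬ R v u.
  record IsGovernedStutteringBisimulation (R : Rel V 0ℓ) : Set where
    field
      isEquivalence : IsEquivalence R
      priority      : ∀ {v w} → R v w → Ω v ≡ Ω w
      transfer      : ∀ {v w} → R v w → ∀ u → ¬ R v u → (v •) ≬ R u →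
                      ForcesVia (𝒫 v) (R w) w (R u)
      divergence    : ∀ {v w} → R v w → ∀ i →
                      ForcesStaying i (R v) v → ForcesStaying i (R w) w

  GovernedStutteringBisimilar : Rel V (lsuc 0ℓ)
  GovernedStutteringBisimilar v w =
    Σ (Rel V 0ℓ) λ R → IsGovernedStutteringBisimulation R × R v w

GameRelation : Set₂
GameRelation = (G : ParityGame) → Rel (ParityGame.V G) (lsuc 0ℓ)

infix 4 _StrictlyRefines_
_StrictlyRefines_ : GameRelation → GameRelation → Set₁
A StrictlyRefines B =
  (∀ G v w → A G v w → B G v w) ×
  (∃[ G ] ∃[ v ] ∃[ w ] (B G v w × ¬ A G v w))

{-# OPTIONS --safe #-}
-- If R is a governed bisimulation and v R w, then whatever a player can force in
-- one step from v, that player can force up to R in one step from w.  The clauses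
-- of a direct simulation are instances of this.  For stuttering, the reflexive-
-- transitive closure of R is again a governed bisimulation, so a step out of a
-- class is matched by a single step.  If a player can stay in the class of v
-- forever, then from every vertex of that class the player can force the next
-- vertex to lie in the class as well.
module Submission where

open import Defs
open import Data.Fin using (Fin; zero; suc)
open import Data.Fin.Properties using (_≟_; sequence)
open import Data.Fin.Subset as Subset using (Subset; ⁅_⁆; _∪_; inside; outside)
open import Data.Fin.Subset.Induction using (Acc; acc; ⊃-wellFounded)
open import Data.Fin.Subset.Properties
  using (_∈?_; x∈⁅x⁆; x∈⁅y⁆⇒x≡y; p⊆p∪q; q⊆p∪q; x∈p∪q⁻)
open import Data.Maybe as Maybe using (Maybe; just; nothing)
open import Data.Maybe.Properties using (just-injective)
open import Data.Nat using (ℕ; zero; suc; s≤s)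
open import Data.Nat.GeneralisedArithmetic using (fold)
open import Data.Product using (∃-syntax; _×_; _,_; proj₁; proj₂)
open import Data.Sum using (_⊎_; inj₁; inj₂; map₂)
open import Data.Sum.Effectful.Left using (applicative)
open import Data.Vec using ([]; _∷_; here; there; lookup)
open import Function using (_∘_; id)
open import Level using (0ℓ)
open import Relation.Binary using (Rel; IsEquivalence; DecidableEquality)
open import Relation.Binary.Construct.Closure.ReflexiveTransitive
  using (Star; ε; _◅_; _◅◅_; reverse; return)
open import Relation.Binary.PropositionalEquality
  using (_≡_; _≢_; refl; sym; trans; cong; subst)
open import Relation.Nullary using (¬_; yes; no; contradiction)
open import Relation.Unary using (Pred; _∈_; _⊆_; _≬_) renaming (Decidable to Decidable₁)

_≟ₚ_ : DecidableEquality Player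
◇ ≟ₚ ◇ = yes refl
◇ ≟ₚ □ = no λ ()
□ ≟ₚ ◇ = no λ ()
□ ≟ₚ □ = yes refl

-- One-step forcing and closure of governed bisimulations.

module _ (G : ParityGame) where
  open ParityGame G
  open Path using (at; start; step)

  Forces-mono : ∀ {i v} {T U : Pred V 0ℓ} → T ⊆ U → Forces G i v T → Forces G i v U
  Forces-mono T⊆U (inj₁ (own , u , v⟶u , u∈T)) = inj₁ (own , u , v⟶u , T⊆U u∈T)
  Forces-mono T⊆U (inj₂ (other , v•⊆T))         = inj₂ (other , T⊆U ∘ v•⊆T)

  module _ {R : Rel V 0ℓ} (bisim : IsGovernedBisimulation G R) where
    open IsGovernedBisimulation bisim

    -- If `w` belongs to `i`, the match of a successor of `v` in `T` is the move; totality supplies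
    -- that successor when `v` is the opponent's. Otherwise each successor of `w` needs a partner in
    -- `T`: `govern` gives it when the owners differ, `transfer` with symmetry when they agree.
    Forces-transport : ∀ {i v w T} → R v w → Forces G i v T → Forces G i w (Image G T R)
    Forces-transport {i} {v} {w} vRw (inj₁ (own , v′ , v⟶v′ , v′∈T)) with 𝒫 w ≟ₚ i
    ... | yes own′ =
      let w′ , w⟶w′ , v′Rw′ = transfer vRw v⟶v′
      in inj₁ (own′ , w′ , w⟶w′ , v′ , v′∈T , v′Rw′)
    ... | no other = inj₂ (other , λ w⟶w′ →
      v′ , v′∈T , govern vRw (λ eq → other (trans (sym eq) own)) v⟶v′ w⟶w′)
    Forces-transport {i} {v} {w} vRw (inj₂ (other , v•⊆T)) with 𝒫 w ≟ₚ i
    ... | yes own =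
      let v′ , v⟶v′         = total v
          w′ , w⟶w′ , v′Rw′ = transfer vRw v⟶v′
      in inj₁ (own , w′ , w⟶w′ , v′ , v•⊆T v⟶v′ , v′Rw′)
    ... | no other′ = inj₂ (other′ , λ w⟶w′ →
      let v′ , v⟶v′ , w′Rv′ = transfer (symmetric vRw) w⟶w′
      in v′ , v•⊆T v⟶v′ , symmetric w′Rv′)

    Forces-matching : ∀ {i v w} → R v w → 𝒫 v ≡ i → ∀ {v′} → v ⟶ v′ → Forces G i w (R v′)
    Forces-matching vRw own {v′} v⟶v′ =
      Forces-mono {T = Image G (v′ ≡_) R} (λ { (_ , refl , r) → r })
        (Forces-transport vRw (inj₁ (own , v′ , v⟶v′ , refl)))

    isDirectSimulation : IsDirectSimulation G R
    isDirectSimulation = record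
      { priority = priority
      ; even     = Forces-matching
      -- From a vertex of `□`, player `◇` forces all of `v •` trivially; transport turns this target
      -- into its image.
      ; odd      = λ vRw v□ →
          Forces-transport vRw (inj₂ ((λ v◇ → contradiction (trans (sym v□) v◇) λ ()) , id))
      }

    -- Needed because `R` is only symmetric, while a governed stuttering bisimulation must be an
    -- equivalence.
    Star-isGovernedBisimulation : IsGovernedBisimulation G (Star R)
    Star-isGovernedBisimulation = record
      { symmetric = symmetric⋆
      ; priority  = priority⋆
      ; govern    = govern⋆
      ; transfer  = transfer⋆
      }
      where
      symmetric⋆ : ∀ {v w} → Star R v w → Star R w v
      symmetric⋆ = reverse symmetric

      priority⋆ : ∀ {v w} → Star R v w → Ω v ≡ Ω w
      priority⋆ ε        = refl
      priority⋆ (r ◅ rs) = trans (priority r) (priority⋆ rs)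

      transfer⋆ : ∀ {v w} → Star R v w →
                  ∀ {v′} → v′ ∈ v • → ∃[ w′ ] (w′ ∈ w • × Star R v′ w′)
      transfer⋆ ε        v⟶v′ = _ , v⟶v′ , ε
      transfer⋆ (r ◅ rs) v⟶v′ =
        let _ , x⟶x′ , r′  = transfer r v⟶v′
            _ , w⟶w′ , rs′ = transfer⋆ rs x⟶x′
        in _ , w⟶w′ , r′ ◅ rs′

      -- Some link of the chain joins vertices of different players; matching
      -- both successors along the chain up to that link relates them.
      govern⋆ : ∀ {v w} → Star R v w → 𝒫 v ≢ 𝒫 w →
                ∀ {v′ w′} → v′ ∈ v • → w′ ∈ w • → Star R v′ w′
      govern⋆ ε 𝒫v≢𝒫v _ _ = contradiction refl 𝒫v≢𝒫v
      govern⋆ {v} {w} (_◅_ {j = x} r rs) 𝒫v≢𝒫w v⟶v′ w⟶w′ with 𝒫 x ≟ₚ 𝒫 w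
      ... | yes 𝒫x≡𝒫w =
        let _ , x⟶x′ , rs′ = transfer⋆ (symmetric⋆ rs) w⟶w′
        in govern r (λ 𝒫v≡𝒫x → 𝒫v≢𝒫w (trans 𝒫v≡𝒫x 𝒫x≡𝒫w)) v⟶v′ x⟶x′ ◅ symmetric⋆ rs′
      ... | no 𝒫x≢𝒫w =
        let _ , x⟶x′ , r′ = transfer r v⟶v′
        in r′ ◅ govern⋆ rs 𝒫x≢𝒫w x⟶x′ w⟶w′

  -- Memoryless strategies and infinite plays.

  choice-strategy : ∀ {i} → (∀ v → Maybe (𝒫 v ≡ i × ∃[ w ] v ⟶ w)) → Strategy G i
  choice-strategy {i} choice = record
    { move  = λ v → Maybe.map target (choice v)
    ; owned = λ {v} → owned (choice v)
    ; legal = λ {v} → legal (choice v)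
    }
    where
    target : ∀ {v} → 𝒫 v ≡ i × (∃[ w ] v ⟶ w) → V
    target = proj₁ ∘ proj₂

    owned : ∀ {v w} (c : Maybe (𝒫 v ≡ i × ∃[ w ] v ⟶ w)) →
            Maybe.map target c ≡ just w → 𝒫 v ≡ i
    owned (just (own , _)) _ = own

    legal : ∀ {v w} (c : Maybe (𝒫 v ≡ i × ∃[ w ] v ⟶ w)) →
            Maybe.map target c ≡ just w → v ⟶ w
    legal (just (_ , _ , v⟶w)) refl = v⟶w

  idle : ∀ {i} → Strategy G i
  idle = choice-strategy λ _ → nothing

  -- Decidability of `D` lets the move be computed from the current vertex. It stays undefined
  -- outside `D` and where all successors lie in `T` anyway.
  one-step-strategy : ∀ {i} {D T : Pred V 0ℓ} → Decidable₁ D →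
    (∀ {x} → x ∈ D → Forces G i x T) →
    ∃[ σ ] (∀ {v} (π : Path G v) → Allows G {i} σ π →
            ∀ n → at π n ∈ D → at π (suc n) ∈ T)
  one-step-strategy {i} {D} {T} D? forces = choice-strategy choice , stays
    where
    choice : ∀ x → Maybe (𝒫 x ≡ i × ∃[ y ] x ⟶ y)
    choice x with D? x
    ... | no _ = nothing
    ... | yes x∈D with forces x∈D
    ...   | inj₁ (own , y , x⟶y , _) = just (own , y , x⟶y)
    ...   | inj₂ _                   = nothing

    -- The premise mentions `choice x` itself, so repeating the case splits of `choice` reduces it.
    leads : ∀ {x y} → x ∈ D → x ⟶ y →
            (∀ {w} → Maybe.map (proj₁ ∘ proj₂) (choice x) ≡ just w → y ≡ w) → y ∈ T
    leads {x} x∈D x⟶y allowed with D? x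
    ... | no x∉D = contradiction x∈D x∉D
    ... | yes x∈D′ with forces x∈D′
    ...   | inj₁ (_ , _ , _ , y∈T) = subst T (sym (allowed refl)) y∈T
    ...   | inj₂ (_ , x•⊆T)        = x•⊆T x⟶y

    stays : ∀ {v} (π : Path G v) → Allows G (choice-strategy choice) π →
            ∀ n → at π n ∈ D → at π (suc n) ∈ T
    stays π allowed n n∈D = leads n∈D (step π n) (allowed n)

  Forces⇒ForcesVia : ∀ {i v} {U T : Pred V 0ℓ} → v ∈ U → Forces G i v T → ForcesVia G i U v T
  Forces⇒ForcesVia {v = v} {U} v∈U forces =
    let σ , stays = one-step-strategy (v ≟_) λ { refl → forces }
    in σ , λ π allowed →
      1 , stays π allowed 0 (sym (start π)) ,
      λ { zero _ → subst U (sym (start π)) v∈U ; (suc _) (s≤s ()) }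

  module _ {i} (σ : Strategy G i) where
    open Strategy σ

    next-move : ∀ x → ∃[ y ] (x ⟶ y × (∀ {w} → move x ≡ just w → y ≡ w))
    next-move x with move x in eq
    ... | just y  = y , legal eq , just-injective
    ... | nothing = let y , x⟶y = total x in y , x⟶y , λ ()

    -- The first step is a parameter, so that any move of the opponent can be followed; afterwards
    -- `next-move` obeys `σ`, with totality filling in where `σ` is undefined.
    play : ∀ {v v′} → v ⟶ v′ → Path G v
    play {v} {v′} v⟶v′ = record
      { at    = λ { zero → v ; (suc n) → fold v′ (proj₁ ∘ next-move) n }
      ; start = refl
      ; step  = λ { zero → v⟶v′ ; (suc n) → proj₁ (proj₂ (next-move _)) }
      }

    play-allowed : ∀ {v v′} (v⟶v′ : v ⟶ v′) → (∀ {w} → move v ≡ just w → v′ ≡ w) →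
                   Allows G σ (play v⟶v′)
    play-allowed v⟶v′ first zero    = first
    play-allowed v⟶v′ first (suc n) = proj₂ (proj₂ (next-move _))

  -- Staying speaks of infinite paths only, so a first step is extended to a full `play` and the
  -- claim is read at position 1.
  ForcesStaying⇒Forces : ∀ {i v} {U : Pred V 0ℓ} → ForcesStaying G i U v → Forces G i v U
  ForcesStaying⇒Forces {i} {v} (σ , stays) with 𝒫 v ≟ₚ i
  ... | yes own =
    let v′ , v⟶v′ , first = next-move σ v
    in inj₁ (own , v′ , v⟶v′ , stays (play σ v⟶v′) (play-allowed σ v⟶v′ first) 1)
  ... | no other = inj₂ (other , λ v⟶v′ →
    stays (play σ v⟶v′)
      (play-allowed σ v⟶v′ λ moved → contradiction (Strategy.owned σ moved) other) 1)

  -- U need not be decidable, so a strategy cannot test membership in it.  It is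
  -- played instead on a finite subset of U from which i can also force
  -- staying inside; a subset without this property can be enlarged within U.
  module _ {i} {U : Pred V 0ℓ} (forces : ∀ {x} → x ∈ U → Forces G i x U) where

    Closed : Subset size → Set
    Closed D = ∀ x → x Subset.∈ D → Forces G i x (Subset._∈ D)

    NewVertex : Subset size → Set
    NewVertex D = ∃[ y ] (y ∈ U × y Subset.∉ D)

    Forces-or-new : ∀ D {x} → Forces G i x U → NewVertex D ⊎ Forces G i x (Subset._∈ D)
    Forces-or-new D (inj₁ (own , y , x⟶y , y∈U)) with y ∈? D
    ... | yes y∈D = inj₂ (inj₁ (own , y , x⟶y , y∈D))
    ... | no y∉D  = inj₁ (y , y∈U , y∉D)
    Forces-or-new D {x} (inj₂ (other , x•⊆U)) =
      -- Sequencing in the sum applicative scans all vertices: either some vertex yields a new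
      -- element, or the inclusion holds at every one.
      map₂ (λ x•⊆D → inj₂ (other , x•⊆D _)) (sequence (applicative _ _) successor)
      where
      successor : ∀ y → NewVertex D ⊎ (x ⟶ y → y Subset.∈ D)
      successor y with y ∈? D | x ⟶? y
      ... | yes y∈D | _       = inj₂ λ _ → y∈D
      ... | no  _   | no x↛y  = inj₂ λ x⟶y → contradiction x⟶y x↛y
      ... | no  y∉D | yes x⟶y = inj₁ (y , x•⊆U x⟶y , y∉D)

    closed-or-new : ∀ D → (Subset._∈ D) ⊆ U → NewVertex D ⊎ Closed D
    closed-or-new D D⊆U = sequence (applicative _ _) vertex
      where
      vertex : ∀ x → NewVertex D ⊎ (x Subset.∈ D → Forces G i x (Subset._∈ D))
      vertex x with x ∈? D
      ... | no x∉D  = inj₂ λ x∈D → contradiction x∈D x∉D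
      ... | yes x∈D = map₂ (λ f _ → f) (Forces-or-new D (forces (D⊆U x∈D)))

    -- Each round adds a vertex of `U` outside `D`, and subsets of a finite set cannot grow forever.
    closed-superset : ∀ D → Acc Subset._⊃_ D → (Subset._∈ D) ⊆ U →
                      ∃[ E ] (D Subset.⊆ E × (Subset._∈ E) ⊆ U × Closed E)
    closed-superset D (acc larger) D⊆U with closed-or-new D D⊆U
    ... | inj₂ closed = D , id , D⊆U , closed
    ... | inj₁ (y , y∈U , y∉D) =
      let D⊆D′ = p⊆p∪q ⁅ y ⁆
          y∈D′ = q⊆p∪q D ⁅ y ⁆ (x∈⁅x⁆ y)
          E , D′⊆E , E⊆U , closed =
            closed-superset (D ∪ ⁅ y ⁆) (larger (D⊆D′ , y , y∈D′ , y∉D)) D′⊆U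
      in E , D′⊆E ∘ D⊆D′ , E⊆U , closed
      where
      D′⊆U : (Subset._∈ (D ∪ ⁅ y ⁆)) ⊆ U
      D′⊆U x∈D′ with x∈p∪q⁻ D ⁅ y ⁆ x∈D′
      ... | inj₁ x∈D = D⊆U x∈D
      ... | inj₂ x∈y = subst U (sym (x∈⁅y⁆⇒x≡y y x∈y)) y∈U

    invariant⇒ForcesStaying : ∀ {w} → w ∈ U → ForcesStaying G i U w
    invariant⇒ForcesStaying {w} w∈U =
      let E , w⊆E , E⊆U , closed =
            closed-superset ⁅ w ⁆ (⊃-wellFounded _)
              (λ x∈w → subst U (sym (x∈⁅y⁆⇒x≡y w x∈w)) w∈U)
          σ , stays = one-step-strategy (_∈? E) (closed _)
      in σ , λ π allowed n → E⊆U (induct {Subset._∈ E} π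
           (subst (Subset._∈ E) (sym (start π)) (w⊆E (x∈⁅x⁆ w))) (stays π allowed) n)
      where
      induct : ∀ {P : Pred V 0ℓ} (π : Path G w) → at π 0 ∈ P →
               (∀ n → at π n ∈ P → at π (suc n) ∈ P) → ∀ n → at π n ∈ P
      induct π base ind zero    = base
      induct {P} π base ind (suc n) = ind n (induct {P} π base ind n)

  -- From governed bisimulation equivalences to stuttering.

  module _ {R : Rel V 0ℓ} (bisim : IsGovernedBisimulation G R) (equiv : IsEquivalence R) where
    open IsGovernedBisimulation bisim
    private module E = IsEquivalence equiv

    isGovernedStutteringBisimulation : IsGovernedStutteringBisimulation G R
    isGovernedStutteringBisimulation = record
      { isEquivalence = equiv
      ; priority      = priority
      ; transfer      = λ { {w = w} vRw u _ (_ , v⟶v′ , uRv′) →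
          Forces⇒ForcesVia {U = R w} {T = R u} E.refl
            (Forces-mono (E.trans uRv′) (Forces-matching bisim vRw refl v⟶v′)) }
      -- Forcing `R v` in one step from `v` transports to every `x` in the class, and the image of a
      -- class under `R` is the class itself.
      ; divergence    = λ {_} {w} vRw i staying →
          invariant⇒ForcesStaying {U = R w}
            (λ wRx → Forces-mono
              (λ { (_ , vRy , yRx′) → E.trans (E.sym vRw) (E.trans vRy yRx′) })
              (Forces-transport bisim (E.trans vRw wRx) (ForcesStaying⇒Forces staying)))
            E.refl
      }

governed⇒direct : ∀ G v w → GovernedBisimilar G v w → DirectSimulationEquivalent G v w
governed⇒direct G v w (R , bisim , vRw) =
  (R , isDirectSimulation G bisim , vRw) ,
  (R , isDirectSimulation G bisim , IsGovernedBisimulation.symmetric bisim vRw)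

governed⇒stuttering : ∀ G v w → GovernedBisimilar G v w → GovernedStutteringBisimilar G v w
governed⇒stuttering G v w (R , bisim , vRw) =
  Star R , isGovernedStutteringBisimulation G bisim⋆ equiv , return vRw
  where
  bisim⋆ = Star-isGovernedBisimulation G bisim
  equiv : IsEquivalence (Star R)
  equiv = record
    { refl  = ε
    ; sym   = IsGovernedBisimulation.symmetric bisim⋆
    ; trans = _◅◅_
    }

-- The two counterexamples have a sink, vertex 0, which alone has priority 1.
sink-priority : ∀ {n} → Fin n → ℕ
sink-priority zero    = 1
sink-priority (suc _) = 0

-- Strictness for direct simulation equivalence.

module DirectCounterexample where

  -- Vertex 2 simulates vertex 1, which cannot reach the sink, so the extra
  -- edge from 3 to 1 is invisible to simulation equivalence of 2 and 3.
  successors : Fin 4 → Subset 4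
  successors = lookup
    ( (inside  ∷ outside ∷ outside ∷ outside ∷ [])
    ∷ (outside ∷ inside  ∷ outside ∷ outside ∷ [])
    ∷ (inside  ∷ outside ∷ inside  ∷ outside ∷ [])
    ∷ (inside  ∷ inside  ∷ inside  ∷ outside ∷ [])
    ∷ [])

  game : ParityGame
  game = record
    { size  = 4
    ; _⟶_   = λ v w → w Subset.∈ successors v
    ; _⟶?_  = λ v w → w ∈? successors v
    ; total = λ { zero                   → zero , here
                ; (suc zero)             → suc zero , there here
                ; (suc (suc zero))       → zero , here
                ; (suc (suc (suc zero))) → zero , here }
    ; Ω     = sink-priority
    ; 𝒫     = λ _ → ◇
    }

  -- Vertices 2 and 3 can both move to the sink and to 2, so each simulates every vertex of priority
  -- 0.
  data _≼_ : Rel (Fin 4) 0ℓ where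
    sink : zero ≼ zero
    up   : ∀ {x y} → suc x ≼ suc (suc y)

  ≼-isDirectSimulation : IsDirectSimulation game _≼_
  ≼-isDirectSimulation = record
    { priority = λ { sink → refl ; up → refl }
    ; even     = λ v≼w _ v⟶v′ → inj₁ (refl , step v≼w v⟶v′)
    ; odd      = λ _ ()
    }
    where
    step : ∀ {v w v′} → v ≼ w → v′ Subset.∈ successors v → (Subset._∈ successors w) ≬ (v′ ≼_)
    step sink here = zero , here , sink
    step {v′ = zero}  (up {y = zero})     _ = zero , here , sink
    step {v′ = zero}  (up {y = suc zero}) _ = zero , here , sink
    step {v′ = suc _} (up {y = zero})     _ = suc (suc zero) , there (there here) , up
    step {v′ = suc _} (up {y = suc zero}) _ = suc (suc zero) , there (there here) , up
    step sink (there (there (there (there ()))))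

  equivalent : DirectSimulationEquivalent game (suc (suc (suc zero))) (suc (suc zero))
  equivalent = (_≼_ , ≼-isDirectSimulation , up) , (_≼_ , ≼-isDirectSimulation , up)

  -- The edge from 3 to 1 could only be matched by staying at 2; but then the edge from 2 to the
  -- sink has no match at 1, which only loops.
  not-bisimilar : ¬ GovernedBisimilar game (suc (suc (suc zero))) (suc (suc zero))
  not-bisimilar (R , bisim , r) = refute (transfer r (there here))
    where
    open IsGovernedBisimulation bisim
    refute : ¬ (∃[ w ] (w Subset.∈ successors (suc (suc zero)) × R (suc zero) w))
    refute (_ , here , r₁) = contradiction (priority r₁) λ ()
    refute (_ , there (there (there (there ()))) , _)
    refute (_ , there (there here) , r₁) with transfer (symmetric r₁) here
    ... | _ , there here , r₂ = contradiction (priority r₂) λ ()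
    ... | _ , there (there (there (there ()))) , _

-- Strictness for governed stuttering bisimilarity.

module StutteringCounterexample where

  -- Vertices 2 and 1 differ only in the number of steps to the sink, which stuttering ignores.
  descend : Fin 3 → Fin 3
  descend zero             = zero
  descend (suc zero)       = zero
  descend (suc (suc zero)) = suc zero

  game : ParityGame
  game = record
    { size  = 3
    ; _⟶_   = λ v w → descend v ≡ w
    ; _⟶?_  = λ v w → descend v ≟ w
    ; total = λ v → descend v , refl
    ; Ω     = sink-priority
    ; 𝒫     = λ _ → ◇
    }

  open ParityGame game using (V; Ω)
  open Path using (at; start; step)

  _≈_ : Rel V 0ℓ
  v ≈ w = Ω v ≡ Ω w

  -- With one path from each vertex, strategies make no difference and `idle` suffices below.
  path-unique : ∀ {v} (π : Path game v) n → at π n ≡ fold v descend n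
  path-unique π zero    = start π
  path-unique π (suc n) = trans (sym (step π n)) (cong descend (path-unique π n))

  path : ∀ v → Path game v
  path v = record { at = fold v descend ; start = refl ; step = λ _ → refl }

  ≈-sink : ∀ {v} → Ω v ≡ 1 → v ≡ zero
  ≈-sink {zero} _ = refl

  sink-stays : ∀ n → fold zero descend n ≡ zero
  sink-stays zero    = refl
  sink-stays (suc n) = cong descend (sink-stays n)

  Ω-twice : ∀ v → Ω (descend (descend v)) ≡ 1
  Ω-twice zero             = refl
  Ω-twice (suc zero)       = refl
  Ω-twice (suc (suc zero)) = refl

  -- The classes are the sink and the pair 1, 2; the only edge between them goes from 1 to the sink,
  -- reached from `w` in one or two steps.
  ≈-transfer : ∀ {v w} → v ≈ w → ∀ u → ¬ (v ≈ u) → (descend v ≡_) ≬ (u ≈_) →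
               ForcesVia game ◇ (w ≈_) w (u ≈_)
  ≈-transfer {zero} _ _ v≉u (_ , refl , u≈v′) = contradiction (sym u≈v′) v≉u
  ≈-transfer {suc (suc zero)} _ _ v≉u (_ , refl , u≈v′) = contradiction (sym u≈v′) v≉u
  ≈-transfer {suc zero} {suc zero} _ _ _ (_ , refl , u≈0) = idle game , λ π _ →
    1 , trans u≈0 (cong Ω (sym (path-unique π 1))) ,
    λ { zero _ → cong Ω (sym (path-unique π 0)) ; (suc _) (s≤s ()) }
  ≈-transfer {suc zero} {suc (suc zero)} _ _ _ (_ , refl , u≈0) = idle game , λ π _ →
    2 , trans u≈0 (cong Ω (sym (path-unique π 2))) ,
    λ { zero       _ → cong Ω (sym (path-unique π 0))
      ; (suc zero) _ → cong Ω (sym (path-unique π 1))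
      ; (suc (suc _)) (s≤s (s≤s ())) }

  ≈-divergence : ∀ {v w} → v ≈ w → ∀ i → ForcesStaying game i (v ≈_) v →
                 ForcesStaying game i (w ≈_) w
  ≈-divergence {v} v≈w i (σ , stays)
    -- Every path is at the sink by position 2, so staying in the class of `v` makes it the sink's
    -- class. Edges are equations here, so `legal` itself shows that `σ` allows the path.
    with refl ← ≈-sink (trans (sym v≈w) (trans (stays (path v) (λ _ → Strategy.legal σ) 2) (Ω-twice v)))
    = idle game , λ π _ n → cong Ω (sym (trans (path-unique π n) (sink-stays n)))

  equivalent : GovernedStutteringBisimilar game (suc (suc zero)) (suc zero)
  equivalent = _≈_ , record
    { isEquivalence = record { refl = refl ; sym = sym ; trans = trans }
    ; priority      = id
    ; transfer      = λ {v} {w} → ≈-transfer {v} {w}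
    ; divergence    = λ {v} {w} → ≈-divergence {v} {w}
    } , refl

  not-bisimilar : ¬ GovernedBisimilar game (suc (suc zero)) (suc zero)
  not-bisimilar (R , bisim , r) with IsGovernedBisimulation.transfer bisim r refl
  ... | _ , refl , r₁ = contradiction (IsGovernedBisimulation.priority bisim r₁) λ ()

theorem21 : (GovernedBisimilar StrictlyRefines DirectSimulationEquivalent) ×
    (GovernedBisimilar StrictlyRefines GovernedStutteringBisimilar)
theorem21 =
  (governed⇒direct ,
    DirectCounterexample.game , _ , _ ,
    DirectCounterexample.equivalent , DirectCounterexample.not-bisimilar) ,
  (governed⇒stuttering ,
    StutteringCounterexample.game , _ , _ ,
    StutteringCounterexample.equivalent , StutteringCounterexample.not-bisimilar)
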